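{- Let $Q$ be a fixed IPC formula and let $\phi : K \to L$ be the map defined in the context. Then for every IPC formula $Z \in L$, $\phi(Z) \equiv QQZ$, i.e. $\phi(Z) \vdash_L (Z \supset Q) \supset Q$ and $(Z \supset Q) \supset Q \vdash_L \phi(Z)$.
   Context: $K$ is the set of PC formulas: built from propositional variables and a propositional constant $\mathfrak{f}$ using only the conditional $\supset$. $L \subseteq K$ is the set of IPC formulas: built from propositional variables using only $\supset$. IPC has Modus Ponens as its only rule and axioms all instances (with IPC formulas) of $(\#1)\ A \supset (B \supset A)$; $(\#2)\ [A \supset (B \supset C)] \supset [(A \supset B) \supset (A \supset C)]$; $(\mathbb{P})\ [(A \supset B) \supset A] \supset A$. $\Gamma \vdash_L Y$ means there is a deduction of $Y$ from hypotheses $\Gamma$ in IPC; $X \equiv Y$ means $X \vdash_L Y$ and $Y \vdash_L X$. For an IPC formula $Z$ write $QZ := Z \supset Q$ and $QQZ := (Z \supset Q)\supset Q$. The map $\phi : K \to L$ is defined by induction on the number of conditionals: $\phi(\mathfrak{f}) = Q$; $\phi(p) = QQp = (p \supset Q) \supset Q$ for each propositional variable $p$; and $\phi(X \supset Y) = \phi(X) \supset \phi(Y)$. -}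

module Defs where

open import Data.Product using (_×_)
open import Level using (0ℓ)
open import Relation.Unary using (Pred; _∈_; ｛_｝)

infixr 20 _⊃_

data K (Var : Set) : Set where
  𝔣   : K Var
  var : Var → K Var
  _⊃_ : K Var → K Var → K Var

data L (Var : Set) : Set where
  var : Var → L Var
  _⊃_ : L Var → L Var → L Var

module _ {Var : Set} where

  infix 4 _⊢_ _≡ᴸ_

  -- The inclusion L ⊆ K.
  ι : L Var → K Var
  ι (var p) = var p
  ι (X ⊃ Y) = ι X ⊃ ι Y

  data Axiom : Pred (L Var) 0ℓ where
    #1 : ∀ A B   → Axiom (A ⊃ (B ⊃ A))
    #2 : ∀ A B C → Axiom ((A ⊃ (B ⊃ C)) ⊃ ((A ⊃ B) ⊃ (A ⊃ C)))
    ℙ  : ∀ A B   → Axiom (((A ⊃ B) ⊃ A) ⊃ A)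

  data _⊢_ (Γ : Pred (L Var) 0ℓ) : Pred (L Var) 0ℓ where
    hyp : ∀ {A}   → A ∈ Γ → Γ ⊢ A
    ax  : ∀ {A}   → A ∈ Axiom → Γ ⊢ A
    mp  : ∀ {A B} → Γ ⊢ A ⊃ B → Γ ⊢ A → Γ ⊢ B

  _≡ᴸ_ : L Var → L Var → Set
  X ≡ᴸ Y = (｛ X ｝ ⊢ Y) × (｛ Y ｝ ⊢ X)

  QQ : L Var → L Var → L Var
  QQ Q Z = (Z ⊃ Q) ⊃ Q

  φ : L Var → K Var → L Var
  φ Q 𝔣       = Q
  φ Q (var p) = QQ Q (var p)
  φ Q (X ⊃ Y) = φ Q X ⊃ φ Q Y

{-# OPTIONS --safe #-}
module Submission where

open import Defs
open import Data.Product using (_,_)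
open import Data.Sum using (inj₁; inj₂)
open import Level using (0ℓ)
open import Relation.Binary.PropositionalEquality using (refl)
open import Relation.Unary using (Pred; _⊆_; _∪_; ｛_｝)

-- Induction on Z: the variable case is an identity, and the conditional case
-- is QQX ⊃ QQY ≡ QQ(X ⊃ Y).  Only the left-to-right half needs Peirce's law.

-- Read `_ ⊃ Q` as negation. `φ` double-negates only the variables; since `QQ Q` commutes with `⊃`
-- up to equivalence (`QQ-⊃-intro`, `QQ-⊃-elim`), these double negations can be pulled out to the
-- whole formula.

module _ {Var : Set} where

  private
    variable
      Γ Δ : Pred (L Var) 0ℓ
      A A′ B B′ : L Var

  infixl 5 _,,_

  _,,_ : Pred (L Var) 0ℓ → L Var → Pred (L Var) 0ℓ
  Γ ,, A = Γ ∪ ｛ A ｝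

  ⊢-mono : Γ ⊆ Δ → Γ ⊢ A → Δ ⊢ A
  ⊢-mono Γ⊆Δ (hyp A∈Γ) = hyp (Γ⊆Δ A∈Γ)
  ⊢-mono Γ⊆Δ (ax a)    = ax a
  ⊢-mono Γ⊆Δ (mp d e)  = mp (⊢-mono Γ⊆Δ d) (⊢-mono Γ⊆Δ e)

  weaken : Γ ⊢ A → Γ ,, B ⊢ A
  weaken = ⊢-mono inj₁

  top : Γ ,, A ⊢ A
  top = hyp (inj₂ refl)

  ⊃-const : Γ ⊢ B → Γ ⊢ A ⊃ B
  ⊃-const = mp (ax (#1 _ _))

  ⊃-refl : Γ ⊢ A ⊃ A
  ⊃-refl {A = A} = mp (mp (ax (#2 A (A ⊃ A) A)) (ax (#1 _ _))) (ax (#1 _ _))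

  deduction : Γ ,, A ⊢ B → Γ ⊢ A ⊃ B
  deduction (hyp (inj₁ B∈Γ))  = ⊃-const (hyp B∈Γ)
  deduction (hyp (inj₂ refl)) = ⊃-refl
  deduction (ax a)            = ⊃-const (ax a)
  deduction (mp d e)          = mp (mp (ax (#2 _ _ _)) (deduction d)) (deduction e)

  -- From (X ⊃ Y) ⊃ Q and X ⊃ Q, Peirce's law on Q and Y gives Q: assuming
  -- Q ⊃ Y, the composite X ⊃ Q ⊃ Y yields X ⊃ Y, hence Q.
  QQ-⊃-intro : ∀ Q X Y → Γ ⊢ QQ Q X ⊃ QQ Q Y → Γ ⊢ QQ Q (X ⊃ Y)
  QQ-⊃-intro Q X Y d = deduction (mp (mp (weaken d) qqX) ¬Y)
    where
    qqX = deduction (mp (ax (ℙ Q Y))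
            (deduction (mp (weaken (weaken top))
              (deduction (mp (weaken top) (mp (weaken (weaken top)) top))))))
    ¬Y  = deduction (mp (weaken top) (⊃-const top))

  -- Given `Y ⊃ Q`, any proof of `X` refutes `X ⊃ Y`, so `d` yields `Q`. This refutes `X`,
  -- contradicting `QQ Q X`.
  QQ-⊃-elim : ∀ Q X Y → Γ ⊢ QQ Q (X ⊃ Y) → Γ ⊢ QQ Q X ⊃ QQ Q Y
  QQ-⊃-elim Q X Y d =
    deduction (deduction (mp (weaken top)
      (deduction (mp (weaken (weaken (weaken d)))
        (deduction (mp (weaken (weaken top)) (mp top (weaken top))))))))

  ⊃-map : Γ ,, A′ ⊢ A → Γ ,, B ⊢ B′ → Γ ⊢ A ⊃ B → Γ ⊢ A′ ⊃ B′
  ⊃-map a b f = deduction (mp (weaken (deduction b)) (mp (weaken f) a))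

  mutual
    -- The two directions are mutual because `⊃` is contravariant on the left. `Γ` is arbitrary so
    -- that the induction hypotheses apply under the extra assumption used by `⊃-map`.
    φ⇒QQ : ∀ Q Z → Γ ⊢ φ Q (ι Z) → Γ ⊢ QQ Q Z
    φ⇒QQ Q (var p) d = d
    φ⇒QQ Q (X ⊃ Y) d =
      QQ-⊃-intro Q X Y (⊃-map (QQ⇒φ Q X top) (φ⇒QQ Q Y top) d)

    QQ⇒φ : ∀ Q Z → Γ ⊢ QQ Q Z → Γ ⊢ φ Q (ι Z)
    QQ⇒φ Q (var p) d = d
    QQ⇒φ Q (X ⊃ Y) d =
      ⊃-map (φ⇒QQ Q X top) (QQ⇒φ Q Y top) (QQ-⊃-elim Q X Y d)

theorem5 : (Var : Set) (Q Z : L Var) → φ Q (ι Z) ≡ᴸ QQ Q Z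
theorem5 Var Q Z = φ⇒QQ Q Z (hyp refl) , QQ⇒φ Q Z (hyp refl)
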